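{- Let $\Psi$ be a set of atomic propositions. The logic $\mathrm{RSOL}$ is complete with respect to $\mathrm{SOL}$: for all terms $t,u\in\mathcal L_\Psi$, $$ \vdash_{\mathrm{SOL}} t\leq u \ \Rightarrow\ \vdash_{\mathrm{RSOL}} t\leq u .$$
   Context: A bounded orthoposet $\langle P,\leq,{}^\bot\rangle$ is a partially ordered set with least element $0$ and greatest element $1$ and an orthocomplementation $a\mapsto a^\bot$, i.e. an order-reversing involution ($a\le b\Rightarrow b^\bot\le a^\bot$, $a^{\bot\bot}=a$) such that for every $a$ the meet of $a$ and $a^\bot$ exists and is $0$, and their join exists and is $1$. A Sasaki orthoposet is a tuple $\langle P,\leq,{}^\bot,\&\rangle$ where $\langle P,\leq,{}^\bot\rangle$ is a bounded orthoposet and $\&:P^2\to P$ is a total binary operation such that for all $a,b,c\in P$: (L-Monotony) $a\le b \Rightarrow a\,\&\,c\le b\,\&\,c$; (R-Reduction) $a\,\&\,b\le b$; (Orthomodularity) $a\le b\Rightarrow a=a\,\&\,b$; (Galois) $a\,\&\,b\le c\Rightarrow c^\bot\,\&\,b\le a^\bot$. Terms: $\mathcal L_\Psi$ is the set of terms generated by the grammar $t ::= p \mid t\,\&\,t \mid t^\bot$ with $p\in\Psi$ (purely syntactic; $t^{\bot\bot}$ is a different term from $t$). Semantics ($\mathrm{SOL}$): a $\Psi$-Sasaki model $\mathcal M$ is a Sasaki orthoposet $\langle P,\leq_P,{}^{\bot_P},\&_P\rangle$ together with a function $\nu:\Psi\to P$. The interpretation $[\![\cdot]\!]_{\mathcal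 M}:\mathcal L_\Psi\to P$ is defined inductively by $[\![p]\!]_{\mathcal M}=\nu(p)$ for $p\in\Psi$, $[\![t^\bot]\!]_{\mathcal M}=([\![t]\!]_{\mathcal M})^{\bot_P}$, $[\![t_1\,\&\,t_2]\!]_{\mathcal M}=[\![t_1]\!]_{\mathcal M}\,\&_P\,[\![t_2]\!]_{\mathcal M}$. One writes $\vdash_{\mathrm{SOL}} t_1\leq t_2$ iff $[\![t_1]\!]_{\mathcal M}\leq_P[\![t_2]\!]_{\mathcal M}$ for every $\Psi$-Sasaki model $\mathcal M$. Rules ($\mathrm{RSOL}$): $\vdash_{\mathrm{RSOL}} a\leq b$ means the formal inequality $a\le b$ is derivable by finite proof trees from the following rules, for arbitrary terms $a,b,c,d\in\mathcal L_\Psi$: ($A$) infer $a\leq a$ (no premise); ($S$) from $b^\bot\leq a^\bot$ infer $a\leq b$; ($G$) from $c^\bot\,\&\,b\leq a^\bot$ infer $a\,\&\,b\leq c$; ($N_L$) from $a\leq b$ infer $a^{\bot\bot}\leq b$; ($N_R$) from $a\leq b$ infer $a\leq b^{\bot\bot}$; ($T$) from $a\leq b$ and $b\leq c$ infer $a\leq c$; ($O_L$) from $a\leq b$ and $a\leq c$ infer $a\,\&\,b\leq c$; ($O_R$) from $a\leq b$ and $a\leq c$ infer $a\leq b\,\&\,c$; ($R$) from $b\leq c$ infer $a\,\&\,b\leq c$; ($M$) from $a\leq c$, $b\leq d$ and $d\leq b$ infer $a\,\&\,b\leq c\,\&\,d$. -}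

module Defs where

open import Algebra.Core using (Op₁; Op₂)
open import Algebra.Definitions using (Congruent₂; Involutive)
open import Data.Product using (_×_)
open import Function using (flip)
open import Level using (Level; suc; _⊔_)
open import Relation.Binary.Bundles using (Poset)
open import Relation.Binary.Core using (Rel)
open import Relation.Binary.Definitions
  using (Minimum; Maximum; Antitonic₁; RightMonotonic)

private
  variable
    a ℓ : Level

-- `IsJoin _≤_ x y j`: the join of x and y exists and is j.  (The library's
-- `Supremum` would require all binary joins to exist.)
IsJoin : {A : Set a} → Rel A ℓ → A → A → A → Set (a ⊔ ℓ)
IsJoin _≤_ x y j = x ≤ j × y ≤ j × (∀ z → x ≤ z → y ≤ z → j ≤ z)

IsMeet : {A : Set a} → Rel A ℓ → A → A → A → Set (a ⊔ ℓ)
IsMeet _≤_ = IsJoin (flip _≤_)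

-- As in the library's order hierarchy, equality of elements is the poset's
-- equivalence `_≈_`, with respect to which `_≤_` is antisymmetric.

record BoundedOrthoposet c ℓ₁ ℓ₂ : Set (suc (c ⊔ ℓ₁ ⊔ ℓ₂)) where
  infixl 8 _⊥
  field
    poset : Poset c ℓ₁ ℓ₂
  open Poset poset public
  field
    0#           : Carrier
    1#           : Carrier
    _⊥           : Op₁ Carrier
    minimum      : Minimum _≤_ 0#
    maximum      : Maximum _≤_ 1#
    ⊥-antitonic  : Antitonic₁ _≤_ _≤_ _⊥
    ⊥-involutive : Involutive _≈_ _⊥
    ⊥-meet       : ∀ x → IsMeet _≤_ x (x ⊥) 0#
    ⊥-join       : ∀ x → IsJoin _≤_ x (x ⊥) 1#

record SasakiOrthoposet c ℓ₁ ℓ₂ : Set (suc (c ⊔ ℓ₁ ⊔ ℓ₂)) where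
  infixl 7 _&_
  field
    boundedOrthoposet : BoundedOrthoposet c ℓ₁ ℓ₂
  open BoundedOrthoposet boundedOrthoposet public
  field
    _&_           : Op₂ Carrier
    -- Automatic when `_≈_` is propositional equality.  For `_⊥` and the left
    -- argument of `_&_` it already follows from monotonicity.
    &-cong        : Congruent₂ _≈_ _&_
    l-monotony    : RightMonotonic _≤_ _≤_ _&_
    r-reduction   : ∀ x y → (x & y) ≤ y
    orthomodular  : ∀ {x y} → x ≤ y → x ≈ (x & y)
    galois        : ∀ {x y z} → (x & y) ≤ z → ((z ⊥) & y) ≤ (x ⊥)

infixl 8 _⊥
infixl 7 _&_

data Term (Ψ : Set ℓ) : Set ℓ where
  atom : Ψ → Term Ψ
  _&_  : Term Ψ → Term Ψ → Term Ψ
  _⊥   : Term Ψ → Term Ψ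

-- Models live in the same universe as Ψ.
record SasakiModel (Ψ : Set ℓ) : Set (suc ℓ) where
  field
    sasakiOrthoposet : SasakiOrthoposet ℓ ℓ ℓ
  module P = SasakiOrthoposet sasakiOrthoposet
  field
    ν : Ψ → P.Carrier

  ⟦_⟧ : Term Ψ → P.Carrier
  ⟦ atom p ⟧ = ν p
  ⟦ t & u ⟧  = ⟦ t ⟧ P.& ⟦ u ⟧
  ⟦ t ⊥ ⟧    = ⟦ t ⟧ P.⊥

infix 4 ⊢SOL_≼_ ⊢RSOL_≼_

⊢SOL_≼_ : {Ψ : Set ℓ} → Term Ψ → Term Ψ → Set (suc ℓ)
⊢SOL_≼_ {Ψ = Ψ} t u =
  (𝓜 : SasakiModel Ψ) → let open SasakiModel 𝓜 in ⟦ t ⟧ P.≤ ⟦ u ⟧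

data ⊢RSOL_≼_ {Ψ : Set ℓ} : Term Ψ → Term Ψ → Set ℓ where
  A  : ∀ {a} → ⊢RSOL a ≼ a
  S  : ∀ {a b} → ⊢RSOL b ⊥ ≼ a ⊥ → ⊢RSOL a ≼ b
  G  : ∀ {a b c} → ⊢RSOL c ⊥ & b ≼ a ⊥ → ⊢RSOL a & b ≼ c
  Nₗ : ∀ {a b} → ⊢RSOL a ≼ b → ⊢RSOL a ⊥ ⊥ ≼ b
  Nᵣ : ∀ {a b} → ⊢RSOL a ≼ b → ⊢RSOL a ≼ b ⊥ ⊥
  T  : ∀ {a b c} → ⊢RSOL a ≼ b → ⊢RSOL b ≼ c → ⊢RSOL a ≼ c
  Oₗ : ∀ {a b c} → ⊢RSOL a ≼ b → ⊢RSOL a ≼ c → ⊢RSOL a & b ≼ c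
  Oᵣ : ∀ {a b c} → ⊢RSOL a ≼ b → ⊢RSOL a ≼ c → ⊢RSOL a ≼ b & c
  R  : ∀ {a b c} → ⊢RSOL b ≼ c → ⊢RSOL a & b ≼ c
  M  : ∀ {a b c d} → ⊢RSOL a ≼ c → ⊢RSOL b ≼ d → ⊢RSOL d ≼ b →
       ⊢RSOL a & b ≼ c & d

{-# OPTIONS --safe #-}

-- The terms preordered by derivability form a Sasaki orthoposet in which every
-- term denotes itself.  The language has no constants, but rule G applied to
-- c ⊥ & t ⊥ ≼ t ⊥ gives t & t ⊥ ≼ c for every c, so t & t ⊥ is a least element
-- as soon as there is some term t.

module Submission where

open import Defs
open import Data.Product using (_×_; _,_; proj₁; proj₂; swap; zip)
open import Function using (flip)
open import Level using (Level)
open import Relation.Binary.Bundles using (Poset)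
open import Relation.Binary.PropositionalEquality
  using (_≡_; refl; cong; cong₂; subst₂)

private
  variable
    ℓ : Level
    Ψ : Set ℓ

≼-antitone : {a b : Term Ψ} → ⊢RSOL a ≼ b → ⊢RSOL b ⊥ ≼ a ⊥
≼-antitone a≼b = S (Nₗ (Nᵣ a≼b))

≼-monoˡ : {a b : Term Ψ} (c : Term Ψ) → ⊢RSOL a ≼ b → ⊢RSOL a & c ≼ b & c
≼-monoˡ _ a≼b = M a≼b A A

-- Rule `G` reduces this to `a ⊥ ⊥ & b ≼ c ⊥ ⊥`, which is the premise up to double negations.
≼-galois : {a b c : Term Ψ} → ⊢RSOL a & b ≼ c → ⊢RSOL c ⊥ & b ≼ a ⊥
≼-galois a&b≼c = G (T (≼-monoˡ _ (Nₗ A)) (Nᵣ a&b≼c))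

t&t⊥-minimum : (t : Term Ψ) {c : Term Ψ} → ⊢RSOL t & t ⊥ ≼ c
t&t⊥-minimum t = G (R A)

-- `Oᵣ` puts `a` below `b & b ⊥`, which is least whatever `b` is.
≼-explosion : {a b c : Term Ψ} → ⊢RSOL a ≼ b → ⊢RSOL a ≼ b ⊥ → ⊢RSOL a ≼ c
≼-explosion a≼b a≼b⊥ = T (Oᵣ a≼b a≼b⊥) (t&t⊥-minimum _)

-- Interderivability is the equality, so the carrier stays the terms themselves instead of a
-- quotient.
termPoset : Set ℓ → Poset ℓ ℓ ℓ
termPoset Ψ = record
  { Carrier = Term Ψ
  ; _≈_     = λ a b → ⊢RSOL a ≼ b × ⊢RSOL b ≼ a
  ; _≤_     = ⊢RSOL_≼_
  ; isPartialOrder = record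
    { isPreorder = record
      { isEquivalence = record
        { refl  = A , A
        ; sym   = swap
        ; trans = zip T (flip T)
        }
      ; reflexive = proj₁
      ; trans     = T
      }
    ; antisym = _,_
    }
  }

termOrthoposet : Term Ψ → BoundedOrthoposet _ _ _
termOrthoposet {Ψ = Ψ} t = record
  { poset        = termPoset Ψ
  ; 0#           = t & t ⊥
  ; 1#           = (t & t ⊥) ⊥
  ; _⊥           = _⊥
  ; minimum      = λ _ → t&t⊥-minimum t
  ; maximum      = λ _ → ≼1
  ; ⊥-antitonic  = ≼-antitone
  ; ⊥-involutive = λ _ → Nₗ A , Nᵣ A
  ; ⊥-meet       = λ _ → t&t⊥-minimum t , t&t⊥-minimum t , λ _ → ≼-explosion
  ; ⊥-join       = λ _ → ≼1 , ≼1 , λ _ x≼z x⊥≼z →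
      -- De Morgan: `z ⊥` lies below both `x ⊥` and `x ⊥ ⊥`, hence below everything.
      S (≼-explosion (≼-antitone x≼z) (≼-antitone x⊥≼z))
  }
  where
  ≼1 : {a : Term Ψ} → ⊢RSOL a ≼ (t & t ⊥) ⊥
  ≼1 = S (Nₗ (t&t⊥-minimum t))

termModel : Term Ψ → SasakiModel Ψ
termModel t = record
  { sasakiOrthoposet = record
    { boundedOrthoposet = termOrthoposet t
    ; _&_          = _&_
    ; &-cong       = λ (a≼b , b≼a) (c≼d , d≼c) → M a≼b c≼d d≼c , M b≼a d≼c c≼d
    ; l-monotony   = λ c → ≼-monoˡ c
    ; r-reduction  = λ _ _ → R A
    -- Once `a ≼ b`, the O-rules make `a` both a lower and an upper bound of `a & b`.
    ; orthomodular = λ a≼b → Oᵣ A a≼b , Oₗ a≼b A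
    ; galois       = ≼-galois
    }
  ; ν = atom
  }

⟦⟧-termModel : (t u : Term Ψ) → SasakiModel.⟦_⟧ (termModel t) u ≡ u
⟦⟧-termModel t (atom p) = refl
⟦⟧-termModel t (u & v)  = cong₂ _&_ (⟦⟧-termModel t u) (⟦⟧-termModel t v)
⟦⟧-termModel t (u ⊥)    = cong _⊥ (⟦⟧-termModel t u)

proposition9 : {ℓ : Level} (Ψ : Set ℓ) (t u : Term Ψ) →
    ⊢SOL t ≼ u → ⊢RSOL t ≼ u
proposition9 Ψ t u valid =
  -- The left-hand side `t` supplies the term from which the bounds are built.
  subst₂ ⊢RSOL_≼_ (⟦⟧-termModel t t) (⟦⟧-termModel t u) (valid (termModel t))
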